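{- Let $\overrightarrow{G}$ be a proper circular arc digraph and let $X_{\overrightarrow{G}}(\mathbf{x},t)$ be its chromatic quasisymmetric function. Then $X_{\overrightarrow{G}}(\mathbf{x},t)\in\Lambda_{\mathbb{Q}}[t]$, i.e. for each $j$ the coefficient of $t^j$ is a symmetric function in $x_1,x_2,\dots$.
   Context: All digraphs are finite and simple; $(u,v)\in E$ is an edge directed from $u$ to $v$. An oriented graph is a digraph with no bidirected edges. $\overrightarrow{K_{12}}$ is the digraph on three vertices $a,b,c$ with exactly the edges $a\to b$ and $a\to c$; $\overrightarrow{K_{21}}$ is the digraph on three vertices $a,b,c$ with exactly the edges $b\to a$ and $c\to a$. In this paper, a proper circular arc digraph means an oriented graph having no induced subdigraph isomorphic to $\overrightarrow{K_{12}}$ or $\overrightarrow{K_{21}}$. For a digraph $\overrightarrow{G}=(V,E)$, a proper coloring is a map $\kappa:V\to\mathbb{P}=\{1,2,3,\dots\}$ with $\kappa(u)\ne\kappa(v)$ whenever $u,v$ are adjacent, $\mathrm{asc}(\kappa)=|\{(u,v)\in E:\kappa(u)<\kappa(v)\}|$, and $$X_{\overrightarrow{G}}(\mathbf{x},t)=\sum_{\kappa}t^{\mathrm{asc}(\kappa)}\prod_{v\in V}x_{\kappa(v)},$$ summed over all proper colorings. $\Lambda_{\mathbb{Q}}$ is the $\mathbb{Q}$-algebra of symmetric functions in $x_1,x_2,\dots$. -}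

module Defs where

open import Data.Fin.Base using (Fin)
open import Data.Fin.Patterns using (0F; 1F; 2F)
open import Data.Fin.Properties using (all?) renaming (_≟_ to _≟ᶠ_)
open import Data.Integer.Base using (+_)
open import Data.List.Base
  using (List; []; _∷_; [_]; length; filter; map; upTo; allFin; cartesianProduct; cartesianProductWith)
open import Data.List.Membership.Propositional using (_∈_)
open import Data.List.Membership.Propositional.Properties
open import Data.List.Membership.Propositional.Properties.WithK using (unique∧set⇒bag)
open import Data.List.Relation.Binary.BagAndSetEquality using (∼bag⇒↭)
open import Data.List.Relation.Binary.Permutation.Propositional.Properties using (↭-length)
open import Data.List.Relation.Unary.All as All using (All)
open import Data.List.Relation.Unary.Any using (here; there)
import Data.List.Relation.Unary.AllPairs as AllPairs
open import Data.List.Relation.Unary.Unique.Propositional using (Unique)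
import Data.List.Relation.Unary.Unique.Propositional.Properties as Unique
open import Data.Nat.Base using (ℕ; zero; suc; _≤_; _<_)
open import Data.Nat.ListAction using (sum)
open import Data.Nat.Properties
  using (_≟_; _<?_; ≤-trans; m≤m+n; m≤n+m; <⇒≱; ≮⇒≥)
open import Data.Product.Base using (Σ; ∃; _×_; _,_; proj₁; proj₂)
open import Data.Product.Properties using (≡-dec)
open import Data.Rational.Base using (ℚ; 0ℚ; _/_)
open import Data.Sum.Base using (_⊎_)
open import Data.Vec.Base using (Vec; []; _∷_; lookup)
open import Data.Vec.Properties using (∷-injective)
open import Function.Base using (_∘_)
open import Function.Bundles using (_↔_; _⇔_; mk⇔; Inverse; Equivalence)
open import Function.Definitions using (Injective)
open import Level using (0ℓ)
open import Relation.Binary.Core using (Rel)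
open import Relation.Binary.Definitions using (Decidable)
open import Relation.Binary.PropositionalEquality
  using (_≡_; _≢_; _≗_; refl; sym; trans; cong; subst)
open import Relation.Nullary using (¬_; Dec; yes; no; contradiction)
open import Relation.Nullary.Decidable using (¬?; _×-dec_; _⊎-dec_; _→-dec_)

------------------------------------------------------------------------
-- Digraphs

-- Opposite edges u ⟶ v and v ⟶ u may coexist; loops may not.
record Digraph : Set₁ where
  infix 4 _⟶_ _⟶?_
  field
    order  : ℕ
    _⟶_    : Rel (Fin order) 0ℓ
    _⟶?_   : Decidable _⟶_
    irrefl : ∀ {v} → ¬ (v ⟶ v)

  Vertex : Set
  Vertex = Fin order

  Adjacent : Rel Vertex 0ℓ
  Adjacent u v = u ⟶ v ⊎ v ⟶ u

Oriented : Digraph → Set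
Oriented G = ∀ u v → ¬ (u ⟶ v × v ⟶ u)
  where open Digraph G

-- H is isomorphic to the subdigraph of G induced on the image of an
-- injection that preserves and reflects edges.
HasInduced : Digraph → Digraph → Set
HasInduced G H = Σ (H.Vertex → G.Vertex) λ f →
    Injective _≡_ _≡_ f × (∀ u v → (u H.⟶ v) ⇔ (f u G.⟶ f v))
  where
  module G = Digraph G
  module H = Digraph H

private
  infix 4 _∈?_
  _∈?_ : ∀ {n} → Decidable (_∈_ {A = Fin n × Fin n})
  _∈?_ = DecMembership._∈?_
    where import Data.List.Membership.DecPropositional (≡-dec _≟ᶠ_ _≟ᶠ_) as DecMembership

-- The vertices a, b, c are 0F, 1F, 2F.
K⃗₁₂ : Digraph
K⃗₁₂ = record
  { order  = 3
  ; _⟶_    = λ u v → (u , v) ∈ edges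
  ; _⟶?_   = λ u v → (u , v) ∈? edges
  ; irrefl = λ { (here ()) ; (there (here ())) ; (there (there ())) }
  }
  where
  edges : List (Fin 3 × Fin 3)
  edges = (0F , 1F) ∷ (0F , 2F) ∷ []

K⃗₂₁ : Digraph
K⃗₂₁ = record
  { order  = 3
  ; _⟶_    = λ u v → (u , v) ∈ edges
  ; _⟶?_   = λ u v → (u , v) ∈? edges
  ; irrefl = λ { (here ()) ; (there (here ())) ; (there (there ())) }
  }
  where
  edges : List (Fin 3 × Fin 3)
  edges = (1F , 0F) ∷ (2F , 0F) ∷ []

ProperCircularArc : Digraph → Set
ProperCircularArc G = Oriented G × ¬ HasInduced G K⃗₁₂ × ¬ HasInduced G K⃗₂₁

------------------------------------------------------------------------
-- Formal power series in x₁, x₂, … over ℚ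

-- i : ℙ stands for the positive integer i + 1, so the variables are
-- indexed from zero; the order on ℙ is that of ℕ.
ℙ : Set
ℙ = ℕ

-- All variables of index at least `bound` have exponent zero; `bound`
-- need not be the least such number.
record Monomial : Set where
  field
    exponent : ℙ → ℕ
    bound    : ℕ
    vanishes : ∀ {i} → bound ≤ i → exponent i ≡ 0

open Monomial public

infix 4 _≈ᵐ_
_≈ᵐ_ : Rel Monomial 0ℓ
α ≈ᵐ β = exponent α ≗ exponent β

degree : Monomial → ℕ
degree α = sum (map (exponent α) (upTo (bound α)))

record PowerSeries : Set where
  field
    coeff      : Monomial → ℚ
    coeff-cong : ∀ {α β} → α ≈ᵐ β → coeff α ≡ coeff β

open PowerSeries public

private
  ≤-sum : ∀ {n ns} → n ∈ ns → n ≤ sum ns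
  ≤-sum (here refl)              = m≤m+n _ _
  ≤-sum {ns = m ∷ _} (there n∈ns) = ≤-trans (≤-sum n∈ns) (m≤n+m _ m)

-- The image of α under the substitution xᵢ ↦ x_{σ(i)}.
permute : ℙ ↔ ℙ → Monomial → Monomial
permute σ α = record
  { exponent = exponent α ∘ σ.from
  ; bound    = sum images
  ; vanishes = λ {j} B≤j → vanishes α (≮⇒≥ λ σ⁻¹j<b → <⇒≱ (j<B j σ⁻¹j<b) B≤j)
  }
  where
  module σ = Inverse σ

  images : List ℕ
  images = map (suc ∘ σ.to) (upTo (bound α))

  j<B : ∀ j → σ.from j < bound α → j < sum images
  j<B j σ⁻¹j<b = subst (_< sum images) (σ.strictlyInverseˡ j)
    (≤-sum (∈-map⁺ (suc ∘ σ.to) (∈-upTo⁺ σ⁻¹j<b)))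

BoundedDegree : PowerSeries → Set
BoundedDegree F = ∃ λ d → ∀ α → d < degree α → coeff F α ≡ 0ℚ

Symmetric : PowerSeries → Set
Symmetric F = ∀ (σ : ℙ ↔ ℙ) α → coeff F (permute σ α) ≡ coeff F α

IsSymmetricFunction : PowerSeries → Set
IsSymmetricFunction F = BoundedDegree F × Symmetric F

-- A power series in t with coefficients in ℚ⟦x₁, x₂, …⟧, given by its
-- sequence of coefficients.
PowerSeries[[t]] : Set
PowerSeries[[t]] = ℕ → PowerSeries

infix 4 _∈Λ[t]
_∈Λ[t] : PowerSeries[[t]] → Set
F ∈Λ[t] = (∃ λ d → ∀ j → d < j → ∀ α → coeff (F j) α ≡ 0ℚ)
        × (∀ j → IsSymmetricFunction (F j))

------------------------------------------------------------------------
-- Colorings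

-- κ as the vector of its values; equality of vectors is then equality
-- of maps, without function extensionality.
Coloring : ℕ → Set
Coloring n = Vec ℙ n

colorings : (n N : ℕ) → List (Coloring n)
colorings zero    N = [ [] ]
colorings (suc n) N = cartesianProductWith _∷_ (upTo N) (colorings n N)

∈-colorings⁺ : ∀ {n N} (κ : Coloring n) → (∀ v → lookup κ v < N) → κ ∈ colorings n N
∈-colorings⁺ []      κ<N = here refl
∈-colorings⁺ (c ∷ κ) κ<N =
  ∈-cartesianProductWith⁺ _∷_ (∈-upTo⁺ (κ<N 0F)) (∈-colorings⁺ κ (κ<N ∘ Fin.suc))

∈-colorings⁻ : ∀ {n N} (κ : Coloring n) → κ ∈ colorings n N → ∀ v → lookup κ v < N
∈-colorings⁻ {suc n} {N} (c ∷ κ) κ∈ v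
  with _ , _ , c∈ , κ∈′ , refl ← ∈-cartesianProductWith⁻ _∷_ (upTo N) (colorings n N) κ∈
  with v
... | Fin.zero  = ∈-upTo⁻ c∈
... | Fin.suc w = ∈-colorings⁻ κ κ∈′ w

colorings-unique : ∀ n N → Unique (colorings n N)
colorings-unique zero    N = All.[] AllPairs.∷ AllPairs.[]
colorings-unique (suc n) N =
  Unique.cartesianProductWith⁺ _∷_ ∷-injective (Unique.upTo⁺ N) (colorings-unique n N)

-- The exponent of xᵢ in ∏ᵥ x_{κ(v)}.
content : ∀ {n} → Coloring n → ℙ → ℕ
content {n} κ i = length (filter (λ v → lookup κ v ≟ i) (allFin n))

private
  content≢0 : ∀ {n} (κ : Coloring n) v → content κ (lookup κ v) ≢ 0
  content≢0 {n} κ v = nonempty (∈-filter⁺ (λ w → lookup κ w ≟ lookup κ v) (∈-allFin v) refl)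
    where
    nonempty : ∀ {xs : List (Fin n)} {x} → x ∈ xs → length xs ≢ 0
    nonempty (here _)  ()
    nonempty (there _) ()

  content≡0 : ∀ {n} (κ : Coloring n) {i} → (∀ v → lookup κ v ≢ i) → content κ i ≡ 0
  content≡0 {n} κ {i} avoids = empty _ λ v∈ →
    avoids _ (proj₂ (∈-filter⁻ (λ v → lookup κ v ≟ i) {xs = allFin n} v∈))
    where
    empty : ∀ (xs : List (Fin n)) → (∀ {x} → ¬ x ∈ xs) → length xs ≡ 0
    empty []       _   = refl
    empty (x ∷ xs) x∉ = contradiction (here refl) x∉

------------------------------------------------------------------------
-- The chromatic quasisymmetric function

module Chromatic (G : Digraph) where
  open Digraph G

  Proper : Coloring order → Set
  Proper κ = ∀ u v → Adjacent u v → lookup κ u ≢ lookup κ v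

  proper? : ∀ κ → Dec (Proper κ)
  proper? κ = all? λ u → all? λ v →
    ((u ⟶? v) ⊎-dec (v ⟶? u)) →-dec ¬? (lookup κ u ≟ lookup κ v)

  asc : Coloring order → ℕ
  asc κ = length (filter (λ (u , v) → (u ⟶? v) ×-dec (lookup κ u <? lookup κ v))
                         (cartesianProduct (allFin order) (allFin order)))

  -- κ is a proper coloring contributing t ^ j · x ^ α to the sum.
  Contributes : ℕ → Monomial → Coloring order → Set
  Contributes j α κ = Proper κ × asc κ ≡ j × content κ ≗ exponent α

  -- A coloring of content α uses only colors below `bound α`, so these
  -- are finitely many; see ∈-contributing.
  contributing : ℕ → Monomial → List (Coloring order)
  contributing j α = filter contributes? (colorings order (bound α))
    where
    contributes? : ∀ κ → Dec (Proper κ × asc κ ≡ j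
                              × All (λ i → content κ i ≡ exponent α i) (upTo (bound α)))
    contributes? κ = proper? κ ×-dec (asc κ ≟ j)
      ×-dec All.all? (λ i → content κ i ≟ exponent α i) (upTo (bound α))

  contributing-unique : ∀ j α → Unique (contributing j α)
  contributing-unique j α = Unique.filter⁺ _ (colorings-unique order (bound α))

  ∈-contributing : ∀ j α κ → κ ∈ contributing j α ⇔ Contributes j α κ
  ∈-contributing j α κ = mk⇔ to from
    where
    to : κ ∈ contributing j α → Contributes j α κ
    to κ∈ with κ∈′ , proper , asc≡j , agree ← ∈-filter⁻ _ {xs = colorings order (bound α)} κ∈
      = proper , asc≡j , agree′
      where
      agree′ : content κ ≗ exponent α
      agree′ i with i <? bound α
      ... | yes i<b = All.lookup agree (∈-upTo⁺ i<b)
      ... | no  i≮b = trans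
        (content≡0 κ λ { v refl → i≮b (∈-colorings⁻ κ κ∈′ v) })
        (sym (vanishes α (≮⇒≥ i≮b)))

    from : Contributes j α κ → κ ∈ contributing j α
    from (proper , asc≡j , agree) = ∈-filter⁺ _ (∈-colorings⁺ κ colors<b)
      (proper , asc≡j , All.tabulate λ {i} _ → agree i)
      where
      colors<b : ∀ v → lookup κ v < bound α
      colors<b v with lookup κ v <? bound α
      ... | yes c<b = c<b
      ... | no  c≮b = contradiction
        (trans (agree (lookup κ v)) (vanishes α (≮⇒≥ c≮b))) (content≢0 κ v)

  -- The coefficient of t ^ j · x ^ α.
  X : PowerSeries[[t]]
  X j = record
    { coeff      = λ α → + length (contributing j α) / 1
    ; coeff-cong = λ {α} {β} α≈β → cong (λ c → + c / 1)
        (↭-length (∼bag⇒↭ (unique∧set⇒bag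
          (contributing-unique j α) (contributing-unique j β)
          (λ {κ} → mk⇔ (transport α β α≈β κ) (transport β α (sym ∘ α≈β) κ)))))
    }
    where
    transport : ∀ α β → α ≈ᵐ β → ∀ κ → κ ∈ contributing j α → κ ∈ contributing j β
    transport α β α≈β κ κ∈
      with proper , asc≡j , agree ← Equivalence.to (∈-contributing j α κ) κ∈
      = Equivalence.from (∈-contributing j β κ)
          (proper , asc≡j , λ i → trans (agree i) (α≈β i))

open Chromatic public using (X)

{-# OPTIONS --safe #-}
-- It suffices to exchange two adjacent colors i, i + 1. Let W be the set of vertices with these
-- colors in a proper coloring κ. Two out-neighbors of u in W would share a color, so be
-- nonadjacent and induce K⃗₁₂; with K⃗₂₁ for in-neighbors, the edges inside W form disjoint
-- directed paths and directed cycles. Let τ reflect each path and rotate each cycle by one step,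
-- and put κ′ = (i i+1) ∘ κ ∘ τ. As τ is a bijection depending only on W, the contents of i and
-- i + 1 are exchanged. On a cycle κ′ = κ; on a path the reflection reverses edges and the color
-- exchange reverses ascents; edges leaving W compare as before since no color lies strictly
-- between i and i + 1. So κ ↦ κ′ preserves asc, and it is an involution.
module Submission where

open import Defs
open import Data.Bool.Base using (Bool; true; false)
open import Data.Bool.Properties using (¬-not) renaming (_≟_ to _≟ᵇ_)
open import Data.Fin.Base using (Fin; toℕ)
open import Data.Fin.Patterns using (0F; 1F; 2F)
open import Data.Fin.Properties using (any?; pigeonhole; toℕ≤pred[n]) renaming (_≟_ to _≟ᶠ_)
open import Data.Integer.Base using () renaming (+_ to pos)
open import Data.List.Base
  using (List; []; _∷_; _++_; [_]; length; filter; map; concat; upTo; applyUpTo; allFin; cartesianProduct)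
open import Data.List.Membership.Propositional using (_∈_)
open import Data.List.Membership.Propositional.Properties
  using (∈-∃++; ∈-++⁺ˡ; ∈-++⁺ʳ; ∈-++⁻; ∈-filter⁺; ∈-filter⁻; ∈-allFin; ∈-cartesianProduct⁺; ∈-upTo⁺; ∈-map⁺; ∈-map⁻)
open import Data.List.Membership.Propositional.Properties.WithK using (unique∧set⇒bag)
open import Data.List.Properties
  using (map-cong; map-∘; map-upTo; ++-assoc; length-filter; length-++; length-tabulate)
open import Data.List.Relation.Binary.BagAndSetEquality using (∼bag⇒↭)
open import Data.List.Relation.Binary.Disjoint.Propositional using (Disjoint)
open import Data.List.Relation.Binary.Permutation.Propositional as ↭ using (_↭_)
open import Data.List.Relation.Binary.Permutation.Propositional.Properties using (map⁺; ∷↭∷ʳ)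
import Data.List.Relation.Unary.All as All
import Data.List.Relation.Unary.All.Properties as All
open import Data.List.Relation.Unary.AllPairs as AllPairs using (_∷_; [])
import Data.List.Relation.Unary.AllPairs.Properties as AllPairs
open import Data.List.Relation.Unary.Any using (here; there)
open import Data.List.Relation.Unary.Unique.Propositional using (Unique)
import Data.List.Relation.Unary.Unique.Propositional.Properties as Unique
open import Data.Nat.Base using (ℕ; zero; suc; _+_; _∸_; _≤_; _<_; z≤n; s≤s; s≤s⁻¹)
open import Data.Nat.ListAction using (sum)
open import Data.Nat.Properties
  using ( _≟_; _<?_; ≤-antisym; ≤-reflexive; ≤-trans; ≤∧≢⇒<; <-trans; <⇒≱; ≮⇒≥; n<1+n; m<n⇒m<1+n
        ; +-suc; +-comm; m+[n∸m]≡n; m∸n+n≡m; module ≤-Reasoning)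
open import Data.Product.Base using (∃; ∃₂; _×_; _,_; proj₁; proj₂)
open import Data.Rational.Base using (ℚ; 0ℚ; _/_)
open import Data.Sum.Base using (_⊎_; inj₁; inj₂)
open import Data.Vec.Base as Vec using (Vec; lookup; tabulate)
open import Data.Vec.Properties using (lookup-map; lookup∘tabulate; tabulate∘lookup; tabulate-cong)
open import Function.Base using (_∘_; id; case_of_)
open import Function.Bundles using (mk⇔; Inverse; Equivalence)
open import Level using (0ℓ)
open import Relation.Binary.Core using (Rel)
open import Relation.Binary.Definitions using (Decidable)
open import Relation.Binary.PropositionalEquality
  using (_≡_; _≢_; _≗_; refl; sym; trans; cong; cong₂; subst; subst₂; module ≡-Reasoning)
open import Relation.Nullary using (¬_; Dec; yes; no; does; contradiction)
open import Relation.Nullary.Decidable using (¬?; _×-dec_)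

-- Counting by injections

-- Induction on `xs`: the image of the head is cut out of `ys`, and injectivity keeps the remaining
-- images inside what is left. The map receives the membership proof because recoloring a listed
-- coloring requires that it be proper.
length-injection : ∀ {A B : Set} {xs : List A} {ys : List B} → Unique xs →
  (f : ∀ {x} → x ∈ xs → B) →
  (∀ {x y} (p : x ∈ xs) (q : y ∈ xs) → f p ≡ f q → x ≡ y) →
  (∀ {x} (p : x ∈ xs) → f p ∈ ys) →
  length xs ≤ length ys
length-injection [] f f-inj f∈ = z≤n
length-injection {xs = x ∷ xs} {ys} (x∉xs ∷ xs!) f f-inj f∈
  with as , bs , refl ← ∈-∃++ (f∈ (here refl)) = begin
    suc (length xs)                  ≤⟨ s≤s (length-injection xs! (f ∘ there) (λ p q → f-inj (there p) (there q)) rest) ⟩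
    suc (length (as ++ bs))          ≡⟨ cong suc (length-++ as) ⟩
    suc (length as + length bs)      ≡⟨ +-suc (length as) (length bs) ⟨
    length as + suc (length bs)      ≡⟨ length-++ as ⟨
    length (as ++ f (here refl) ∷ bs) ∎
  where
  open ≤-Reasoning
  rest : ∀ {y} (p : y ∈ xs) → f (there p) ∈ as ++ bs
  rest p with ∈-++⁻ as (f∈ (there p))
  ... | inj₁ ∈as         = ∈-++⁺ˡ ∈as
  ... | inj₂ (here fp≡)  = contradiction (f-inj (here refl) (there p) (sym fp≡)) (All.lookup x∉xs p)
  ... | inj₂ (there ∈bs) = ∈-++⁺ʳ as ∈bs

-- Paths and cycles of a partial injection, and the bijection `τ`

-- `R` is the graph of an injective partial map on a finite set, so its components are directed
-- paths and directed cycles. Decidability allows a search for the ends of the paths.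
record PartialInjection {n} (R : Rel (Fin n) 0ℓ) : Set where
  field
    _R?_       : Decidable R
    functional : ∀ {u v w} → R u v → R u w → v ≡ w
    injective  : ∀ {u v w} → R u w → R v w → u ≡ v

module Walks {n} (R : Rel (Fin n) 0ℓ) where

  private
    V : Set
    V = Fin n

    variable
      u v v′ w w′ s e : V
      k l p q : ℕ

  data Walk : ℕ → Rel V 0ℓ where
    []  : Walk 0 v v
    _∷_ : R u v → Walk k v w → Walk (suc k) u w

  _++ʷ_ : Walk k u v → Walk l v w → Walk (k + l) u w
  []        ++ʷ vw = vw
  (r ∷ uv) ++ʷ vw = r ∷ (uv ++ʷ vw)

  snoc : Walk k u v → R v w → Walk (suc k) u w
  snoc []       r′ = r′ ∷ []
  snoc (r ∷ uv) r′ = r ∷ snoc uv r′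

  unsnoc : Walk (suc k) u w → ∃ λ v → Walk k u v × R v w
  unsnoc (r ∷ []) = _ , [] , r
  unsnoc (r ∷ rs@(_ ∷ _)) with _ , uv , r′ ← unsnoc rs = _ , r ∷ uv , r′

  split : ∀ k → Walk (k + l) u w → ∃ λ v → Walk k u v × Walk l v w
  split zero    uw       = _ , [] , uw
  split (suc k) (r ∷ uw) with _ , uv , vw ← split k uw = _ , r ∷ uv , vw

  -- The successor in `Cyclic` excludes the empty closed walk.
  Source Sink Cyclic : V → Set
  Source v = ∀ u → ¬ R u v
  Sink   v = ∀ w → ¬ R v w
  Cyclic v = ∃ λ k → Walk (suc k) v v

  -- On a path the partner is the mirror image; a cycle has no midpoint to reflect in,
  -- but there the successor serves equally well.
  data Partner (v w : V) : Set where
    path  : Source s → Sink e → Walk p s v → Walk q v e → Walk q s w → Walk p w e → Partner v w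
    cycle : Cyclic v → R v w → Partner v w

module Reversal {n} {R : Rel (Fin n) 0ℓ} (pinj : PartialInjection R) where
  open PartialInjection pinj
  open Walks R

  private
    V : Set
    V = Fin n

    variable
      u v v′ w w′ s e : V
      k l p q : ℕ

  end-unique : Walk k u v → Walk k u w → v ≡ w
  end-unique []       []         = refl
  end-unique (r ∷ uv) (r′ ∷ uw) with refl ← functional r r′ = end-unique uv uw

  start-unique : Walk k u w → Walk k v w → u ≡ v
  start-unique []       []         = refl
  start-unique (r ∷ uw) (r′ ∷ vw) with refl ← start-unique uw vw = injective r r′

  cyclic-step : Cyclic v → R v w → Cyclic w
  cyclic-step (k , (r ∷ wv)) r′ with refl ← functional r r′ = k , snoc wv r′

  cyclic-step⁻ : Cyclic w → R v w → Cyclic v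
  cyclic-step⁻ (k , ww) r with x , wx , r′ ← unsnoc ww with refl ← injective r r′ = k , r ∷ wx

  cyclic-walk : Walk k v w → Cyclic v → Cyclic w
  cyclic-walk []       c = c
  cyclic-walk (r ∷ vw) c = cyclic-walk vw (cyclic-step c r)

  cyclic⇒¬sink : Walk k v e → Sink e → ¬ Cyclic v
  cyclic⇒¬sink ve sink c with _ , r ∷ _ ← cyclic-walk ve c = sink _ r

  revisit : k < l → Walk k v w → Walk l v w → Cyclic v
  revisit {k} {l} {v} {w} k<l vw vw′
    -- The last `k` steps of the longer walk end where the shorter walk ends, so they also start at
    -- `v`. Hence the first `l - k` steps are closed; writing their number as a successor makes the
    -- closed walk visibly nonempty.
    with y , vy , yw ← split (suc (l ∸ suc k))
           (subst (λ m → Walk m v w) (trans (sym (m∸n+n≡m k<l)) (+-suc (l ∸ suc k) k)) vw′)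
    with refl ← start-unique vw yw = _ , vy

  -- A walk of `n` steps visits `n + 1` positions, so two of its prefixes end at the same vertex.
  long-walk⇒cyclic : Walk n v w → Cyclic v
  long-walk⇒cyclic {v} vw = let i , j , i<j , eq = pigeonhole (n<1+n n) (proj₁ ∘ prefix) in
    revisit i<j (proj₂ (prefix i)) (subst (Walk (toℕ j) v) (sym eq) (proj₂ (prefix j)))
    where
    prefix : (i : Fin (suc n)) → ∃ (Walk (toℕ i) v)
    prefix i with x , vx , _ ← split (toℕ i) (subst (λ l → Walk l v _) (sym (m+[n∸m]≡n (toℕ≤pred[n] i))) vw) = x , vx

  -- A search with `k` steps of fuel. If the fuel runs out, the walk found has length `k`, which for
  -- `k = n` forces a cycle.
  forward : ∀ k v → (∃₂ λ q e → Walk q v e × Sink e) ⊎ (∃ λ w → Walk k v w)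
  forward zero    v = inj₂ (v , [])
  forward (suc k) v with any? (v R?_)
  ... | no  sink = inj₁ (0 , v , [] , λ w r → sink (w , r))
  ... | yes (u , r) with forward k u
  ...   | inj₁ (q , e , ue , sink) = inj₁ (suc q , e , r ∷ ue , sink)
  ...   | inj₂ (w , uw)            = inj₂ (w , r ∷ uw)

  backward : ∀ k v → (∃₂ λ p s → Walk p s v × Source s) ⊎ (∃ λ u → Walk k u v)
  backward zero    v = inj₂ (v , [])
  backward (suc k) v with any? (_R? v)
  ... | no  source = inj₁ (0 , v , [] , λ u r → source (u , r))
  ... | yes (w , r) with backward k w
  ...   | inj₁ (p , s , sw , source) = inj₁ (suc p , s , snoc sw r , source)
  ...   | inj₂ (u , uw)              = inj₂ (u , snoc uw r)

  cyclic-partner : Cyclic v → ∃ (Partner v)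
  cyclic-partner c@(_ , r ∷ _) = _ , cycle c r

  mirror : Source s → Sink e → Walk p s v → Walk q v e → ∃ (Partner v)
  mirror {s} {e} {p} {v} {q} source sink sv ve
    -- The whole path has `p + q` edges; cutting it after `q` steps instead of `p` gives the mirror
    -- image of `v`.
    with w , sw , we ← split q (subst (λ l → Walk l s e) (+-comm p q) (sv ++ʷ ve))
    = w , path source sink sv ve sw we

  acyclic-partner : Walk q v e → Sink e → ∃ (Partner v)
  acyclic-partner {v = v} ve sink with backward n v
  ... | inj₁ (_ , _ , sv , source) = mirror source sink sv ve
  -- A walk of length `n` into `v` starts at a cyclic vertex, and cyclicity propagates along it to
  -- `v`, which however leads to a sink.
  ... | inj₂ (_ , uv) = contradiction (cyclic-walk uv (long-walk⇒cyclic uv)) (cyclic⇒¬sink ve sink)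

  partner : ∀ v → ∃ (Partner v)
  partner v with forward n v
  ... | inj₁ (_ , _ , ve , sink) = acyclic-partner ve sink
  ... | inj₂ (_ , vw)            = cyclic-partner (long-walk⇒cyclic vw)

  -- Predecessors are unique, so both walks agree when read backwards, and a source stops both at
  -- once. Thus `p` is determined by `v`, which makes the reflection well defined.
  source-unique : Source s → Source w → Walk p s v → Walk q w v → p ≡ q × s ≡ w
  source-unique {p = zero}  {q = zero}  src src′ []  []  = refl , refl
  source-unique {p = zero}  {q = suc _} src src′ []  wv  = contradiction (proj₂ (proj₂ (unsnoc wv))) (src _)
  source-unique {p = suc _} {q = zero}  src src′ sv  []  = contradiction (proj₂ (proj₂ (unsnoc sv))) (src′ _)
  source-unique {p = suc _} {q = suc _} src src′ sv  wv
    with _ , sx , r ← unsnoc sv | _ , wy , r′ ← unsnoc wv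
    with refl ← injective r r′
    with refl , refl ← source-unique src src′ sx wy = refl , refl

  sink-unique : Sink e → Sink w → Walk p v e → Walk q v w → p ≡ q
  sink-unique snk snk′ []       []        = refl
  sink-unique snk snk′ []       (r ∷ _)   = contradiction r (snk _)
  sink-unique snk snk′ (r ∷ _)  []        = contradiction r (snk′ _)
  sink-unique snk snk′ (r ∷ ve) (r′ ∷ vw) with refl ← functional r r′ = cong suc (sink-unique snk snk′ ve vw)

  partner-unique : Partner v w → Partner v w′ → w ≡ w′
  partner-unique (path src snk sv ve sw _) (path src′ snk′ sv′ ve′ sw′ _)
    with refl , refl ← source-unique src src′ sv sv′ | refl ← sink-unique snk snk′ ve ve′ = end-unique sw sw′
  partner-unique (path _ snk _ ve _ _)  (cycle c _)  = contradiction c (cyclic⇒¬sink ve snk)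
  partner-unique (cycle c _)  (path _ snk _ ve _ _)  = contradiction c (cyclic⇒¬sink ve snk)
  partner-unique (cycle _ r)  (cycle _ r′)            = functional r r′

  -- Reflection is a symmetric relation: exchanging the two pairs of walks exchanges `v` and `w`. On
  -- paths injectivity is therefore uniqueness read backwards.
  partner-injective : Partner v w → Partner v′ w → v ≡ v′
  partner-injective (path src snk sv ve sw we) (path src′ snk′ sv′ ve′ sw′ we′) =
    partner-unique (path src snk sw we sv ve) (path src′ snk′ sw′ we′ sv′ ve′)
  partner-injective (path _ snk _ _ _ we) (cycle c r) = contradiction (cyclic-step c r) (cyclic⇒¬sink we snk)
  partner-injective (cycle c r) (path _ snk _ _ _ we) = contradiction (cyclic-step c r) (cyclic⇒¬sink we snk)
  partner-injective (cycle _ r) (cycle _ r′)           = injective r r′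

  abstract
    -- The searches behind `τ` stay opaque; the facts that follow are all that is used about it.
    τ : V → V
    τ v = proj₁ (partner v)

    τ-partner : ∀ v → Partner v (τ v)
    τ-partner v = proj₂ (partner v)

    τ-injective : τ u ≡ τ v → u ≡ v
    τ-injective {u} {v} τu≡τv = partner-injective (proj₂ (partner u)) (subst (Partner v) (sym τu≡τv) (proj₂ (partner v)))

    -- On a cycle `τ` is a rotation, in general no involution. There the edge from `v` to `τ v` is
    -- recorded instead, since colors alternate along it.
    cyclic-or-involutive : ∀ v → (Cyclic v × R v (τ v)) ⊎ (¬ Cyclic v × τ (τ v) ≡ v)
    cyclic-or-involutive v with partner v
    ... | w , cycle c r                     = inj₁ (c , r)
    ... | w , path src snk sv ve sw we = inj₂
      (cyclic⇒¬sink ve snk , partner-unique (proj₂ (partner w)) (path src snk sw we sv ve))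

    τ-reverses : ¬ Cyclic u → R u v → R (τ v) (τ u)
    τ-reverses {u} {v} ¬c r with partner u
    ... | _ , cycle c _ = contradiction c ¬c
    ... | _ , path src snk su [] sw we = contradiction r (snk _)
    ... | _ , path src snk su (r′ ∷ ve) sw we
      with refl ← functional r r′
      -- `v` is one step closer to the sink than `u`, so its mirror image `x` is the vertex just
      -- before that of `u`.
      with x , sx , r″ ← unsnoc sw
      with refl ← partner-unique (proj₂ (partner v)) (path src snk (snoc su r) ve sx (r″ ∷ we)) = r″

    ¬cyclic-τ : ¬ Cyclic u → ¬ Cyclic (τ u)
    ¬cyclic-τ {u} ¬c with partner u
    ... | _ , cycle c _ = contradiction c ¬c
    ... | _ , path src snk _ _ _ we = cyclic⇒¬sink we snk

    -- An isolated vertex is a path without edges, hence its own mirror image. This applies to every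
    -- vertex outside `W`.
    τ-isolated : (∀ w → ¬ R v w) → (∀ u → ¬ R u v) → τ v ≡ v
    τ-isolated {v} snk src = partner-unique (proj₂ (partner v)) (path src snk [] [] [] [])

  cyclic? : ∀ v → Dec (Cyclic v)
  cyclic? v with cyclic-or-involutive v
  ... | inj₁ (c , _)  = yes c
  ... | inj₂ (¬c , _) = no ¬c

-- Two colorings with the same `W` supply different evidence for the partial injection; `τ` must not
-- depend on that evidence.
τ-irrelevant : ∀ {n} {R : Rel (Fin n) 0ℓ} (pinj pinj′ : PartialInjection R) → Reversal.τ pinj ≗ Reversal.τ pinj′
τ-irrelevant pinj pinj′ v =
  Reversal.partner-unique pinj (Reversal.τ-partner pinj v) (Reversal.τ-partner pinj′ v)

lookup-ext : ∀ {A : Set} {n} {xs ys : Vec A n} → lookup xs ≗ lookup ys → xs ≡ ys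
lookup-ext {xs = xs} {ys} eq =
  trans (sym (tabulate∘lookup xs)) (trans (tabulate-cong eq) (tabulate∘lookup ys))

-- Exchange of two adjacent colors

module _ (i : ℙ) where

  data View : ℙ → Set where
    low   : View i
    high  : View (suc i)
    other : ∀ {c} → c ≢ i → c ≢ suc i → View c

  view : ∀ c → View c
  view c with c ≟ i
  ... | yes refl = low
  ... | no c≢i with c ≟ suc i
  ...   | yes refl = high
  ...   | no c≢1+i = other c≢i c≢1+i

  transpose : ℙ → ℙ
  transpose c with view c
  ... | low       = suc i
  ... | high      = i
  ... | other _ _ = c

  affected : ℙ → Bool
  affected c with view c
  ... | low       = true
  ... | high      = true
  ... | other _ _ = false

  transpose-low : transpose i ≡ suc i
  transpose-low with view i
  ... | low       = refl
  ... | other i≢i _ = contradiction refl i≢i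

  transpose-high : transpose (suc i) ≡ i
  transpose-high with view (suc i)
  ... | high      = refl
  ... | other _ 1+i≢1+i = contradiction refl 1+i≢1+i

  affected-low : affected i ≡ true
  affected-low with view i
  ... | low       = refl
  ... | other i≢i _ = contradiction refl i≢i

  affected-high : affected (suc i) ≡ true
  affected-high with view (suc i)
  ... | high      = refl
  ... | other _ 1+i≢1+i = contradiction refl 1+i≢1+i

  transpose-fixes : ∀ {c} → affected c ≡ false → transpose c ≡ c
  transpose-fixes {c} _ with other _ _ ← view c = refl

  affected-transpose : ∀ c → affected (transpose c) ≡ affected c
  affected-transpose c with view c in eq
  ... | low       = affected-high
  ... | high      = affected-low
  ... | other _ _ rewrite eq = refl

  transpose-involutive : ∀ c → transpose (transpose c) ≡ c
  transpose-involutive c with view c in eq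
  ... | low       = transpose-high
  ... | high      = transpose-low
  ... | other _ _ rewrite eq = refl

  transpose-injective : ∀ {c d} → transpose c ≡ transpose d → c ≡ d
  transpose-injective {c} {d} eq =
    trans (sym (transpose-involutive c)) (trans (cong transpose eq) (transpose-involutive d))

  transpose-other : ∀ {c d} → affected c ≡ true → affected d ≡ true → c ≢ d → transpose c ≡ d
  transpose-other {c} {d} _ _ c≢d with view c | view d
  ... | low  | low  = contradiction refl c≢d
  ... | low  | high = refl
  ... | high | low  = refl
  ... | high | high = contradiction refl c≢d

  -- No color lies strictly between the two affected ones.
  <-affectedʳ : ∀ {c d d′} → affected c ≡ false → affected d ≡ true → affected d′ ≡ true → c < d → c < d′
  <-affectedʳ {c} {d} {d′} _ _ _ c<d with view c | view d | view d′
  ... | other _ _   | low  | low  = c<d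
  ... | other _ _   | low  | high = m<n⇒m<1+n c<d
  ... | other c≢i _ | high | low  = ≤∧≢⇒< (s≤s⁻¹ c<d) c≢i
  ... | other _ _   | high | high = c<d

  <-affectedˡ : ∀ {c d d′} → affected c ≡ false → affected d ≡ true → affected d′ ≡ true → d < c → d′ < c
  <-affectedˡ {c} {d} {d′} _ _ _ d<c with view c | view d | view d′
  ... | other _ _   | low  | low  = d<c
  ... | other _ c≢1+i | low | high = ≤∧≢⇒< d<c (c≢1+i ∘ sym)
  ... | other _ _   | high | low  = <-trans (n<1+n i) d<c
  ... | other _ _   | high | high = d<c

-- Induced subdigraphs on three vertices

module Induced (G : Digraph) (oriented : Oriented G) where
  open Digraph G

  private
    ≢-edge : ∀ {u v} → u ⟶ v → u ≢ v
    ≢-edge u⟶v refl = irrefl u⟶v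

    triple : Vertex → Vertex → Vertex → Fin 3 → Vertex
    triple a b c 0F = a
    triple a b c 1F = b
    triple a b c 2F = c

    triple-injective : ∀ {a b c} → a ≢ b → a ≢ c → b ≢ c → ∀ {x y} → triple a b c x ≡ triple a b c y → x ≡ y
    triple-injective a≢b a≢c b≢c {0F} {0F} _  = refl
    triple-injective a≢b a≢c b≢c {0F} {1F} eq = contradiction eq a≢b
    triple-injective a≢b a≢c b≢c {0F} {2F} eq = contradiction eq a≢c
    triple-injective a≢b a≢c b≢c {1F} {0F} eq = contradiction (sym eq) a≢b
    triple-injective a≢b a≢c b≢c {1F} {1F} _  = refl
    triple-injective a≢b a≢c b≢c {1F} {2F} eq = contradiction eq b≢c
    triple-injective a≢b a≢c b≢c {2F} {0F} eq = contradiction (sym eq) a≢c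
    triple-injective a≢b a≢c b≢c {2F} {1F} eq = contradiction (sym eq) b≢c
    triple-injective a≢b a≢c b≢c {2F} {2F} _  = refl

  -- Orientedness excludes edges back to `a`, and nonadjacency excludes edges between `b` and `c`,
  -- so the two given edges are the only ones.
  induced-K⃗₁₂ : ∀ {a b c} → a ⟶ b → a ⟶ c → b ≢ c → ¬ Adjacent b c → HasInduced G K⃗₁₂
  induced-K⃗₁₂ {a} {b} {c} a⟶b a⟶c b≢c ¬adj =
    triple a b c , triple-injective (≢-edge a⟶b) (≢-edge a⟶c) b≢c , λ u v → mk⇔ to (from u v)
    where
    to : ∀ {u v} → Digraph._⟶_ K⃗₁₂ u v → triple a b c u ⟶ triple a b c v
    to (here refl)         = a⟶b
    to (there (here refl)) = a⟶c
    from : ∀ u v → triple a b c u ⟶ triple a b c v → Digraph._⟶_ K⃗₁₂ u v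
    from 0F 0F e = contradiction e irrefl
    from 0F 1F e = here refl
    from 0F 2F e = there (here refl)
    from 1F 0F e = contradiction (a⟶b , e) (oriented _ _)
    from 1F 1F e = contradiction e irrefl
    from 1F 2F e = contradiction (inj₁ e) ¬adj
    from 2F 0F e = contradiction (a⟶c , e) (oriented _ _)
    from 2F 1F e = contradiction (inj₂ e) ¬adj
    from 2F 2F e = contradiction e irrefl

  induced-K⃗₂₁ : ∀ {a b c} → b ⟶ a → c ⟶ a → b ≢ c → ¬ Adjacent b c → HasInduced G K⃗₂₁
  induced-K⃗₂₁ {a} {b} {c} b⟶a c⟶a b≢c ¬adj =
    triple a b c , triple-injective (≢-edge b⟶a ∘ sym) (≢-edge c⟶a ∘ sym) b≢c , λ u v → mk⇔ to (from u v)
    where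
    to : ∀ {u v} → Digraph._⟶_ K⃗₂₁ u v → triple a b c u ⟶ triple a b c v
    to (here refl)         = b⟶a
    to (there (here refl)) = c⟶a
    from : ∀ u v → triple a b c u ⟶ triple a b c v → Digraph._⟶_ K⃗₂₁ u v
    from 0F 0F e = contradiction e irrefl
    from 0F 1F e = contradiction (b⟶a , e) (oriented _ _)
    from 0F 2F e = contradiction (c⟶a , e) (oriented _ _)
    from 1F 0F e = here refl
    from 1F 1F e = contradiction e irrefl
    from 1F 2F e = contradiction (inj₁ e) ¬adj
    from 2F 0F e = there (here refl)
    from 2F 1F e = contradiction (inj₂ e) ¬adj
    from 2F 2F e = contradiction e irrefl

-- The recoloring and its invariants

module Swap (G : Digraph) (pca : ProperCircularArc G) (i : ℙ) where
  open Digraph G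
  open Chromatic G using (Proper; asc)
  open Induced G (proj₁ pca)

  support : Coloring order → Vec Bool order
  support = Vec.map (affected i)

  -- Indexed by the vertex set `W` rather than by a coloring: a coloring and its recoloring share
  -- `W`, so the same `τ` serves both.
  Edge : Vec Bool order → Rel Vertex 0ℓ
  Edge W u v = u ⟶ v × lookup W u ≡ true × lookup W v ≡ true

  affected-in : ∀ {W κ} → support κ ≡ W → ∀ {v b} → lookup W v ≡ b → affected i (lookup κ v) ≡ b
  affected-in {κ = κ} refl {v} eq = trans (sym (lookup-map v (affected i) κ)) eq

  alternates : ∀ {W} κ → Proper κ → support κ ≡ W → ∀ {u v} → Edge W u v ⊎ Edge W v u →
    transpose i (lookup κ u) ≡ lookup κ v
  alternates {W} κ proper W≡ (inj₁ (u⟶v , u∈ , v∈)) =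
    transpose-other i (affected-in {W} {κ} W≡ u∈) (affected-in {W} {κ} W≡ v∈) (proper _ _ (inj₁ u⟶v))
  alternates {W} κ proper W≡ (inj₂ (v⟶u , v∈ , u∈)) =
    transpose-other i (affected-in {W} {κ} W≡ u∈) (affected-in {W} {κ} W≡ v∈) (proper _ _ (inj₂ v⟶u))

  edge-partialInjection : ∀ κ → Proper κ → PartialInjection (Edge (support κ))
  edge-partialInjection κ proper = record
    { _R?_       = λ u v → (u ⟶? v) ×-dec (lookup W u ≟ᵇ true) ×-dec (lookup W v ≟ᵇ true)
    ; functional = functional′
    ; injective  = injective′
    }
    where
    W : Vec Bool order
    W = support κ

    functional′ : ∀ {u v w} → Edge W u v → Edge W u w → v ≡ w
    functional′ {u} {v} {w} r r′ with v ≟ᶠ w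
    ... | yes v≡w = v≡w
    ... | no  v≢w = contradiction
      (induced-K⃗₁₂ (proj₁ r) (proj₁ r′) v≢w λ adj → proper v w adj
        (trans (sym (alternates κ proper refl (inj₁ r))) (alternates κ proper refl (inj₁ r′))))
      (proj₁ (proj₂ pca))

    injective′ : ∀ {u v w} → Edge W u w → Edge W v w → u ≡ v
    injective′ {u} {v} {w} r r′ with u ≟ᶠ v
    ... | yes u≡v = u≡v
    ... | no  u≢v = contradiction
      (induced-K⃗₂₁ (proj₁ r) (proj₁ r′) u≢v λ adj → proper u v adj
        (trans (sym (alternates κ proper refl (inj₂ r))) (alternates κ proper refl (inj₂ r′))))
      (proj₂ (proj₂ pca))

  abstract
    -- `W` and `pinj` are arguments, not computed from `κ`, so that the same map can be applied
    -- again to its own output.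
    swap : ∀ W → PartialInjection (Edge W) → Coloring order → Coloring order
    swap W pinj κ = tabulate λ v → transpose i (lookup κ (Reversal.τ pinj v))

    lookup-swap : ∀ W (pinj : PartialInjection (Edge W)) κ v →
      lookup (swap W pinj κ) v ≡ transpose i (lookup κ (Reversal.τ pinj v))
    lookup-swap W pinj κ = lookup∘tabulate _

    swap-irrelevant : ∀ W (pinj pinj′ : PartialInjection (Edge W)) κ → swap W pinj κ ≡ swap W pinj′ κ
    swap-irrelevant W pinj pinj′ κ = tabulate-cong λ v → cong (transpose i ∘ lookup κ) (τ-irrelevant pinj pinj′ v)

  module _ W (pinj : PartialInjection (Edge W)) where
    open PartialInjection pinj using (_R?_)
    open Walks (Edge W)
    open Reversal pinj

    private
      isolated : ∀ {v} → lookup W v ≡ false → τ v ≡ v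
      isolated v∉ = τ-isolated
        (λ w r → case trans (sym v∉) (proj₁ (proj₂ r)) of λ ())
        (λ u r → case trans (sym v∉) (proj₂ (proj₂ r)) of λ ())

    module _ κ (proper : Proper κ) (W≡ : support κ ≡ W) where

      private
        κ′ : Coloring order
        κ′ = swap W pinj κ

        κ′-at : ∀ v → lookup κ′ v ≡ transpose i (lookup κ (τ v))
        κ′-at = lookup-swap W pinj κ

        κ-in : ∀ {v b} → lookup W v ≡ b → affected i (lookup κ v) ≡ b
        κ-in = affected-in {W} {κ} W≡

        -- The successor carries the other affected color, and the exchange turns it back into that
        -- of `v`.
        cyclic-fixed : ∀ {v} → Cyclic v → lookup κ′ v ≡ lookup κ v
        cyclic-fixed {v} c with cyclic-or-involutive v
        ... | inj₁ (_ , r)  = trans (κ′-at v) (alternates κ proper W≡ (inj₂ r))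
        ... | inj₂ (¬c , _) = contradiction c ¬c

        outside-fixed : ∀ {v} → lookup W v ≡ false → lookup κ′ v ≡ lookup κ v
        outside-fixed {v} v∉ = trans (κ′-at v)
          (trans (cong (transpose i ∘ lookup κ) (isolated v∉)) (transpose-fixes i (κ-in v∉)))

        -- `τ v` and `τ u` are joined by an edge inside `W`, so exchanging the color of one gives
        -- the color of the other. The colors of `κ′` along an edge are thus those of `κ` along its
        -- mirror image, in the order of that edge's direction.
        path-reversed : ∀ {u v} → ¬ Cyclic u → Edge W u v →
          lookup κ′ u ≡ lookup κ (τ v) × lookup κ′ v ≡ lookup κ (τ u)
        path-reversed {u} {v} ¬c r =
            trans (κ′-at u) (alternates κ proper W≡ (inj₂ (τ-reverses ¬c r)))
          , trans (κ′-at v) (alternates κ proper W≡ (inj₁ (τ-reverses ¬c r)))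

        cyclic-edge : ∀ {u v} → Cyclic u → Edge W u v →
          lookup κ′ u ≡ lookup κ u × lookup κ′ v ≡ lookup κ v
        cyclic-edge c r = cyclic-fixed c , cyclic-fixed (cyclic-step c r)

        τ∈ : ∀ v → lookup W (τ v) ≡ lookup W v
        τ∈ v with lookup W v in eq
        ... | false = trans (cong (lookup W) (isolated eq)) eq
        ... | true with cyclic-or-involutive v
        ...   | inj₁ (_ , r) = proj₂ (proj₂ r)
        -- If `τ v` lay outside `W`, it would be fixed by `τ` and hence equal to `v`, which lies in
        -- `W`.
        ...   | inj₂ (_ , ττv≡v) = ¬-not λ τv∉ → case trans (sym eq)
                 (trans (cong (lookup W) (trans (sym ττv≡v) (isolated τv∉))) τv∉) of λ ()

        κ′-in : ∀ {v b} → lookup W v ≡ b → affected i (lookup κ′ v) ≡ b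
        κ′-in {v} eq = trans (cong (affected i) (κ′-at v))
          (trans (affected-transpose i _) (κ-in (trans (τ∈ v) eq)))

      swap-support : support κ′ ≡ W
      swap-support = lookup-ext λ v → trans (lookup-map v (affected i) κ′) (κ′-in refl)

      private
        <-outside : ∀ {u v} → ¬ (lookup W u ≡ true × lookup W v ≡ true) →
          (lookup κ′ u < lookup κ′ v → lookup κ u < lookup κ v)
        <-outside {u} {v} ¬both κ′u<κ′v with lookup W u in equ | lookup W v in eqv
        ... | false | false = subst₂ _<_ (outside-fixed equ) (outside-fixed eqv) κ′u<κ′v
        ... | false | true  = <-affectedʳ i (κ-in equ) (κ′-in eqv) (κ-in eqv)
                                (subst (_< lookup κ′ v) (outside-fixed equ) κ′u<κ′v)
        ... | true  | false = <-affectedˡ i (κ-in eqv) (κ′-in equ) (κ-in equ)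
                                (subst (lookup κ′ u <_) (outside-fixed eqv) κ′u<κ′v)
        ... | true  | true  = contradiction (refl , refl) ¬both

      -- On paths both the reflection and the color exchange cancel. On cycles `κ′` agrees with `κ`,
      -- so a second application changes nothing either.
      swap-involutive : swap W pinj κ′ ≡ κ
      swap-involutive = lookup-ext λ v → trans (lookup-swap W pinj κ′ v) (pointwise v)
        where
        pointwise : ∀ v → transpose i (lookup κ′ (τ v)) ≡ lookup κ v
        pointwise v with cyclic-or-involutive v
        ... | inj₁ (c , r) = trans (cong (transpose i) (cyclic-fixed (cyclic-step c r))) (alternates κ proper W≡ (inj₂ r))
        ... | inj₂ (_ , ττv≡v) = trans (cong (transpose i) (κ′-at (τ v)))
          (trans (transpose-involutive i _) (cong (lookup κ) ττv≡v))

      private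
        -- With one end in `W`, the colors differ under `affected`. On a cycle they are those of
        -- `κ`; on a path a clash would already occur in `κ` along the mirror edge.
        edge-distinct : ∀ {u v} → u ⟶ v → lookup κ′ u ≢ lookup κ′ v
        edge-distinct {u} {v} u⟶v eq with lookup W u in equ | lookup W v in eqv
        ... | false | false = proper u v (inj₁ u⟶v) (trans (sym (outside-fixed equ)) (trans eq (outside-fixed eqv)))
        ... | false | true  = case trans (sym (κ′-in equ)) (trans (cong (affected i) eq) (κ′-in eqv)) of λ ()
        ... | true  | false = case trans (sym (κ′-in equ)) (trans (cong (affected i) eq) (κ′-in eqv)) of λ ()
        ... | true  | true with cyclic? u
        ...   | yes c  with κ′u , κ′v ← cyclic-edge c (u⟶v , equ , eqv) =
          proper u v (inj₁ u⟶v) (trans (sym κ′u) (trans eq κ′v))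
        ...   | no  ¬c with κ′u , κ′v ← path-reversed ¬c (u⟶v , equ , eqv) =
          proper (τ v) (τ u) (inj₁ (proj₁ (τ-reverses ¬c (u⟶v , equ , eqv)))) (trans (sym κ′u) (trans eq κ′v))

      swap-proper : Proper κ′
      swap-proper u v (inj₁ u⟶v) = edge-distinct u⟶v
      swap-proper u v (inj₂ v⟶u) = edge-distinct v⟶u ∘ sym

      private
        -- The matching of ascents. It is defined on all pairs of vertices so that it is an
        -- involution, from which injectivity follows at once.
        ε : Vertex × Vertex → Vertex × Vertex
        ε (u , v) with u R? v | cyclic? u
        ... | yes _ | no _ = τ v , τ u
        ... | _     | _    = u , v

        ε-involutive : ∀ x → ε (ε x) ≡ x
        ε-involutive (u , v) with u R? v in equ | cyclic? u in eqc
        ... | no _  | _     rewrite equ = refl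
        ... | yes _ | yes _ rewrite equ | eqc = refl
        -- The mirror edge is again an edge inside `W` off the cycles, so the second application
        -- reflects it back.
        ... | yes r | no ¬c with τ v R? τ u | cyclic? (τ v)
        ...   | no ¬r | _     = contradiction (τ-reverses ¬c r) ¬r
        ...   | yes _ | yes c = contradiction (cyclic-step c (τ-reverses ¬c r)) (¬cyclic-τ ¬c)
        ...   | yes _ | no _ with cyclic-or-involutive u | cyclic-or-involutive v
        ...     | inj₁ (c , _) | _ = contradiction c ¬c
        ...     | inj₂ _ | inj₁ (c , _) = contradiction (cyclic-step⁻ c r) ¬c
        ...     | inj₂ (_ , ττu≡u) | inj₂ (_ , ττv≡v) = cong₂ _,_ ττu≡u ττv≡v

        Ascent : Coloring order → Vertex × Vertex → Set
        Ascent μ (u , v) = u ⟶ v × lookup μ u < lookup μ v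

        ε-ascent : ∀ x → Ascent κ′ x → Ascent κ (ε x)
        ε-ascent (u , v) (u⟶v , κ′u<κ′v) with u R? v | cyclic? u
        ... | yes r | yes c with κ′u , κ′v ← cyclic-edge c r = u⟶v , subst₂ _<_ κ′u κ′v κ′u<κ′v
        ... | yes r | no ¬c with κ′u , κ′v ← path-reversed ¬c r = proj₁ (τ-reverses ¬c r) , subst₂ _<_ κ′u κ′v κ′u<κ′v
        ... | no ¬r | _ = u⟶v , <-outside (¬r ∘ (u⟶v ,_)) κ′u<κ′v

      asc-swap-≤ : asc κ′ ≤ asc κ
      asc-swap-≤ = length-injection
        (Unique.filter⁺ _ (Unique.cartesianProduct⁺ (Unique.allFin⁺ order) (Unique.allFin⁺ order)))
        (λ {x} _ → ε x)
        (λ {x} {y} _ _ εx≡εy → trans (sym (ε-involutive x)) (trans (cong ε εx≡εy) (ε-involutive y)))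
        (λ {x} x∈ → ∈-filter⁺ _ (∈-cartesianProduct⁺ (∈-allFin _) (∈-allFin _))
          (ε-ascent x (proj₂ (∈-filter⁻ _ {xs = cartesianProduct (allFin order) (allFin order)} x∈))))

      -- `τ` maps each color class of `κ′` injectively into the class of the exchanged color in `κ`.
      content-swap-≤ : ∀ c → content κ′ c ≤ content κ (transpose i c)
      content-swap-≤ c = length-injection (Unique.filter⁺ _ (Unique.allFin⁺ order))
        (λ {v} _ → τ v) (λ _ _ → τ-injective)
        (λ {v} v∈ → ∈-filter⁺ _ (∈-allFin _) (transpose-injective i
          (trans (sym (κ′-at v)) (trans (proj₂ (∈-filter⁻ _ {xs = allFin order} v∈)) (sym (transpose-involutive i c))))))

    module _ κ (proper : Proper κ) (W≡ : support κ ≡ W) where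

      private
        κ′ : Coloring order
        κ′ = swap W pinj κ

        swap-swap : swap W pinj κ′ ≡ κ
        swap-swap = swap-involutive κ proper W≡

      asc-swap : asc κ′ ≡ asc κ
      -- The reverse inequality is the same bound applied to `κ′`, since swapping twice restores
      -- `κ`.
      asc-swap = ≤-antisym (asc-swap-≤ κ proper W≡)
        (subst (λ μ → asc μ ≤ asc κ′) swap-swap (asc-swap-≤ κ′ (swap-proper κ proper W≡) (swap-support κ proper W≡)))

      content-swap : ∀ c → content κ′ (transpose i c) ≡ content κ c
      content-swap c = ≤-antisym
        (subst (λ d → content κ′ (transpose i c) ≤ content κ d) (transpose-involutive i c)
          (content-swap-≤ κ proper W≡ (transpose i c)))
        (subst (λ μ → content μ c ≤ content κ′ (transpose i c)) swap-swap
          (content-swap-≤ κ′ (swap-proper κ proper W≡) (swap-support κ proper W≡) c))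

  swap-injective : ∀ W W′ (pinj : PartialInjection (Edge W)) (pinj′ : PartialInjection (Edge W′)) {κ μ} →
    Proper κ → Proper μ → support κ ≡ W → support μ ≡ W′ → swap W pinj κ ≡ swap W′ pinj′ μ → κ ≡ μ
  swap-injective W W′ pinj pinj′ {κ} {μ} κ-proper μ-proper κ≡W μ≡W′ eq
    -- A swap preserves the support, so equal images force `W` and `W′` to coincide; one more swap
    -- then recovers both colorings.
    with refl ← trans (sym (swap-support W pinj κ κ-proper κ≡W))
                      (trans (cong support eq) (swap-support W′ pinj′ μ μ-proper μ≡W′)) = begin
      κ                             ≡⟨ swap-involutive W pinj κ κ-proper κ≡W ⟨
      swap W pinj (swap W pinj κ)   ≡⟨ cong (swap W pinj) (trans eq (swap-irrelevant W pinj′ pinj μ)) ⟩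
      swap W pinj (swap W pinj μ)   ≡⟨ swap-involutive W pinj μ μ-proper μ≡W′ ⟩
      μ                             ∎
    where open ≡-Reasoning

  module _ κ (proper : Proper κ) where

    recolor : Coloring order
    recolor = swap (support κ) (edge-partialInjection κ proper) κ

    recolor-proper : Proper recolor
    recolor-proper = swap-proper (support κ) (edge-partialInjection κ proper) κ proper refl

    asc-recolor : asc recolor ≡ asc κ
    asc-recolor = asc-swap (support κ) (edge-partialInjection κ proper) κ proper refl

    content-recolor : ∀ c → content recolor (transpose i c) ≡ content κ c
    content-recolor = content-swap (support κ) (edge-partialInjection κ proper) κ proper refl

  recolor-injective : ∀ κ μ (κ-proper : Proper κ) (μ-proper : Proper μ) →
    recolor κ κ-proper ≡ recolor μ μ-proper → κ ≡ μ
  recolor-injective κ μ κ-proper μ-proper =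
    swap-injective (support κ) (support μ) (edge-partialInjection κ κ-proper) (edge-partialInjection μ μ-proper)
      κ-proper μ-proper refl refl

-- From adjacent transpositions to all permutations of the variables

exponents : List ℕ → ℙ → ℕ
exponents []       _       = 0
exponents (x ∷ xs) zero    = x
exponents (x ∷ xs) (suc i) = exponents xs i

monomial : List ℕ → Monomial
monomial xs = record { exponent = exponents xs ; bound = length xs ; vanishes = vanish xs }
  where
  vanish : ∀ xs {i} → length xs ≤ i → exponents xs i ≡ 0
  vanish []       _           = refl
  vanish (x ∷ xs) (s≤s len≤i) = vanish xs len≤i

exponents-∷ʳ0 : ∀ xs → exponents (xs ++ [ 0 ]) ≗ exponents xs
exponents-∷ʳ0 []       zero    = refl
exponents-∷ʳ0 []       (suc i) = refl
exponents-∷ʳ0 (x ∷ xs) zero    = refl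
exponents-∷ʳ0 (x ∷ xs) (suc i) = exponents-∷ʳ0 xs i

exponents-applyUpTo : ∀ (f : ℙ → ℕ) n → (∀ {i} → n ≤ i → f i ≡ 0) → exponents (applyUpTo f n) ≗ f
exponents-applyUpTo f zero    f≡0 i       = sym (f≡0 z≤n)
exponents-applyUpTo f (suc n) f≡0 zero    = refl
exponents-applyUpTo f (suc n) f≡0 (suc i) = exponents-applyUpTo (f ∘ suc) n (f≡0 ∘ s≤s) i

exponents-at-length : ∀ xs {y ys} → exponents (xs ++ y ∷ ys) (length xs) ≡ y
exponents-at-length []       = refl
exponents-at-length (_ ∷ xs) = exponents-at-length xs

exponents-after-length : ∀ xs {y z ys} → exponents (xs ++ y ∷ z ∷ ys) (suc (length xs)) ≡ z
exponents-after-length []       = refl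
exponents-after-length (_ ∷ xs) = exponents-after-length xs

-- Links permutations of lists to the exchange of adjacent variables: `x` sits at index `length xs`.
exponents-transpose : ∀ xs x y ys c →
  exponents (xs ++ y ∷ x ∷ ys) (transpose (length xs) c) ≡ exponents (xs ++ x ∷ y ∷ ys) c
exponents-transpose xs x y ys c with view (length xs) c
... | low  = trans (exponents-after-length xs) (sym (exponents-at-length xs))
... | high = trans (exponents-at-length xs) (sym (exponents-after-length xs))
... | other c≢l c≢1+l = elsewhere xs c c≢l c≢1+l
  where
  elsewhere : ∀ xs c → c ≢ length xs → c ≢ suc (length xs) →
    exponents (xs ++ y ∷ x ∷ ys) c ≡ exponents (xs ++ x ∷ y ∷ ys) c
  elsewhere []       0             c≢0 _     = contradiction refl c≢0
  elsewhere []       1             _   c≢1   = contradiction refl c≢1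
  elsewhere []       (suc (suc c)) _   _     = refl
  elsewhere (_ ∷ xs) zero          _   _     = refl
  elsewhere (_ ∷ xs) (suc c)       c≢l c≢1+l = elsewhere xs c (c≢l ∘ cong suc) (c≢1+l ∘ cong suc)

nonzero : List ℕ → List ℕ
nonzero = filter (λ x → ¬? (x ≟ 0))

supportOf : Monomial → List ℙ
supportOf α = filter (λ i → ¬? (exponent α i ≟ 0)) (upTo (bound α))

∈-supportOf⁺ : ∀ α {i} → exponent α i ≢ 0 → i ∈ supportOf α
∈-supportOf⁺ α {i} αᵢ≢0 with i <? bound α
... | yes i<b = ∈-filter⁺ _ (∈-upTo⁺ i<b) αᵢ≢0
... | no  i≮b = contradiction (vanishes α (≮⇒≥ i≮b)) αᵢ≢0

∈-supportOf⁻ : ∀ α {i} → i ∈ supportOf α → exponent α i ≢ 0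
∈-supportOf⁻ α i∈ = proj₂ (∈-filter⁻ (λ i → ¬? (exponent α i ≟ 0)) {xs = upTo (bound α)} i∈)

supportOf-unique : ∀ α → Unique (supportOf α)
supportOf-unique α = Unique.filter⁺ _ (Unique.upTo⁺ (bound α))

nonzero-map : ∀ (f : ℙ → ℕ) is → nonzero (map f is) ≡ map f (filter (λ i → ¬? (f i ≟ 0)) is)
nonzero-map f []       = refl
nonzero-map f (i ∷ is) with does (f i ≟ 0)
... | true  = nonzero-map f is
... | false = cong (f i ∷_) (nonzero-map f is)

supportOf-permute : ∀ σ α → map (Inverse.to σ) (supportOf α) ↭ supportOf (permute σ α)
supportOf-permute σ α = ∼bag⇒↭ (unique∧set⇒bag
  (Unique.map⁺ (λ {i} {j} eq → trans (sym (σ.strictlyInverseʳ i)) (trans (cong σ.from eq) (σ.strictlyInverseʳ j)))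
    (supportOf-unique α))
  (supportOf-unique (permute σ α))
  (mk⇔ to from))
  where
  module σ = Inverse σ
  to : ∀ {j} → j ∈ map σ.to (supportOf α) → j ∈ supportOf (permute σ α)
  to j∈ with i , i∈ , refl ← ∈-map⁻ σ.to j∈ =
    ∈-supportOf⁺ (permute σ α) (∈-supportOf⁻ α i∈ ∘ trans (cong (exponent α) (sym (σ.strictlyInverseʳ i))))
  from : ∀ {j} → j ∈ supportOf (permute σ α) → j ∈ map σ.to (supportOf α)
  from {j} j∈ = subst (_∈ map σ.to (supportOf α)) (σ.strictlyInverseˡ j)
    (∈-map⁺ σ.to (∈-supportOf⁺ α (∈-supportOf⁻ (permute σ α) j∈)))

-- A permutation of the variables may move infinitely many of them and so need not be a product of
-- adjacent transpositions. On the finite list of nonzero exponents, however, it acts as a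
-- rearrangement.
permute-↭ : ∀ σ α → map (exponent α) (supportOf α) ↭ map (exponent (permute σ α)) (supportOf (permute σ α))
permute-↭ σ α = subst (_↭ map β (supportOf (permute σ α)))
  (trans (sym (map-∘ (supportOf α))) (map-cong (λ i → cong (exponent α) (Inverse.strictlyInverseʳ σ i)) (supportOf α)))
  (map⁺ β (supportOf-permute σ α))
  where
  β = exponent (permute σ α)

module AdjacentSymmetry (F : PowerSeries)
  (invariant : ∀ i α β → (∀ c → exponent β (transpose i c) ≡ exponent α c) → coeff F α ≡ coeff F β) where

  private
    C : List ℕ → ℚ
    C = coeff F ∘ monomial

  -- The prefix `ps` makes the induction work: a common head is moved into it, and a swap of heads
  -- becomes the adjacent transposition at index `length ps`.
  coeff-↭ : ∀ ps {xs ys} → xs ↭ ys → C (ps ++ xs) ≡ C (ps ++ ys)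
  coeff-↭ ps ↭.refl          = refl
  coeff-↭ ps (↭.trans r r′)  = trans (coeff-↭ ps r) (coeff-↭ ps r′)
  coeff-↭ ps {x ∷ xs} {.x ∷ ys} (↭.prep x r) = subst₂ (λ us vs → C us ≡ C vs)
    (++-assoc ps [ x ] xs) (++-assoc ps [ x ] ys) (coeff-↭ (ps ++ [ x ]) r)
  coeff-↭ ps {x ∷ y ∷ xs} {.y ∷ .x ∷ ys} (↭.swap x y r) = trans
    (invariant (length ps) _ _ (exponents-transpose ps x y xs))
    (subst₂ (λ us vs → C us ≡ C vs)
      (++-assoc ps (y ∷ x ∷ []) xs) (++-assoc ps (y ∷ x ∷ []) ys) (coeff-↭ (ps ++ y ∷ x ∷ []) r))

  coeff-nonzero : ∀ ps xs → C (ps ++ xs) ≡ C (ps ++ nonzero xs)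
  coeff-nonzero ps []       = refl
  coeff-nonzero ps (zero ∷ xs) = begin
    -- A zero exponent is moved to the end, where it does not affect the monomial.
    C (ps ++ 0 ∷ xs)        ≡⟨ coeff-↭ ps (∷↭∷ʳ 0 xs) ⟩
    C (ps ++ xs ++ [ 0 ])   ≡⟨ cong C (++-assoc ps xs [ 0 ]) ⟨
    C ((ps ++ xs) ++ [ 0 ]) ≡⟨ coeff-cong F (exponents-∷ʳ0 (ps ++ xs)) ⟩
    C (ps ++ xs)            ≡⟨ coeff-nonzero ps xs ⟩
    C (ps ++ nonzero xs)    ∎
    where open ≡-Reasoning
  coeff-nonzero ps (suc x ∷ xs) = subst₂ (λ us vs → C us ≡ C vs)
    (++-assoc ps [ suc x ] xs) (++-assoc ps [ suc x ] (nonzero xs)) (coeff-nonzero (ps ++ [ suc x ]) xs)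

  -- A normal form: the coefficient depends only on the list of nonzero exponents.
  coeff-supportOf : ∀ α → coeff F α ≡ C (map (exponent α) (supportOf α))
  coeff-supportOf α = begin
    coeff F α                                    ≡⟨ coeff-cong F (sym ∘ exponents-applyUpTo (exponent α) (bound α) (vanishes α)) ⟩
    C (applyUpTo (exponent α) (bound α))         ≡⟨ cong C (map-upTo (exponent α) (bound α)) ⟨
    C (map (exponent α) (upTo (bound α)))        ≡⟨ coeff-nonzero [] (map (exponent α) (upTo (bound α))) ⟩
    C (nonzero (map (exponent α) (upTo (bound α)))) ≡⟨ cong C (nonzero-map (exponent α) (upTo (bound α))) ⟩
    C (map (exponent α) (supportOf α))           ∎
    where open ≡-Reasoning

  symmetric : Symmetric F
  symmetric σ α = begin
    coeff F (permute σ α)                                      ≡⟨ coeff-supportOf (permute σ α) ⟩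
    C (map (exponent (permute σ α)) (supportOf (permute σ α))) ≡⟨ coeff-↭ [] (permute-↭ σ α) ⟨
    C (map (exponent α) (supportOf α))                         ≡⟨ coeff-supportOf α ⟨
    coeff F α                                                  ∎
    where open ≡-Reasoning

-- Degree of the content of a coloring

length-concat : ∀ {A : Set} (xss : List (List A)) → length (concat xss) ≡ sum (map length xss)
length-concat []         = refl
length-concat (xs ∷ xss) = trans (length-++ xs) (cong (length xs +_) (length-concat xss))

-- The color classes are pairwise disjoint, so joined together they form a list of vertices without
-- repetition.
sum-content-≤ : ∀ {n} (κ : Coloring n) N → sum (map (content κ) (upTo N)) ≤ n
sum-content-≤ {n} κ N = begin
  sum (map (content κ) (upTo N))              ≡⟨ cong sum (map-∘ (upTo N)) ⟩
  sum (map length (map fibre (upTo N)))       ≡⟨ length-concat (map fibre (upTo N)) ⟨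
  length (concat (map fibre (upTo N)))        ≤⟨ length-injection unique (λ {v} _ → v) (λ _ _ → id) (λ _ → ∈-allFin _) ⟩
  length (allFin n)                           ≡⟨ length-tabulate id ⟩
  n                                           ∎
  where
  open ≤-Reasoning

  fibre : ℙ → List (Fin n)
  fibre i = filter (λ v → lookup κ v ≟ i) (allFin n)

  fibre-color : ∀ {i v} → v ∈ fibre i → lookup κ v ≡ i
  fibre-color v∈ = proj₂ (∈-filter⁻ _ {xs = allFin n} v∈)

  disjoint : ∀ {i j} → i ≢ j → Disjoint (fibre i) (fibre j)
  disjoint i≢j (v∈i , v∈j) = i≢j (trans (sym (fibre-color v∈i)) (fibre-color v∈j))

  unique : Unique (concat (map fibre (upTo N)))
  unique = Unique.concat⁺
    (All.map⁺ (All.tabulate λ _ → Unique.filter⁺ _ (Unique.allFin⁺ n)))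
    (AllPairs.map⁺ (AllPairs.map {R = _≢_} {S = λ i j → Disjoint (fibre i) (fibre j)}
        (λ i≢j {v} → disjoint i≢j {v}) (Unique.upTo⁺ N)))

-- Boundedness and symmetry of the chromatic quasisymmetric function

module _ (G : Digraph) where
  open Digraph G
  open Chromatic G using (Proper; Contributes; contributing; contributing-unique; ∈-contributing)

  coeff≡0 : ∀ j α → (∀ κ → ¬ Contributes j α κ) → coeff (X G j) α ≡ 0ℚ
  coeff≡0 j α none with contributing j α in eq
  ... | []    = refl
  ... | κ ∷ _ = contradiction
    (Equivalence.to (∈-contributing j α κ) (subst (κ ∈_) (sym eq) (here refl))) (none κ)

  bounded-t-degree : ∃ λ d → ∀ j → d < j → ∀ α → coeff (X G j) α ≡ 0ℚ
  -- Ascents are selected from all ordered pairs of vertices, whose number therefore bounds the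
  -- degree in t.
  bounded-t-degree = length edges , λ j d<j α → coeff≡0 j α λ κ (_ , asc≡j , _) →
    <⇒≱ d<j (≤-trans (≤-reflexive (sym asc≡j)) (length-filter _ edges))
    where edges = cartesianProduct (allFin order) (allFin order)

  bounded-degree : ∀ j → BoundedDegree (X G j)
  bounded-degree j = order , λ α d<deg → coeff≡0 j α λ κ (_ , _ , content≡) →
    <⇒≱ d<deg (≤-trans (≤-reflexive (cong sum (map-cong (sym ∘ content≡) (upTo (bound α)))))
      (sum-content-≤ κ (bound α)))

  module _ (pca : ProperCircularArc G) where

    -- Recoloring injects the colorings of content `α` into those of content `β`, keeping the number
    -- of ascents.
    contributing-transpose-≤ : ∀ i j α β → (∀ c → exponent β (transpose i c) ≡ exponent α c) →
      length (contributing j α) ≤ length (contributing j β)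
    contributing-transpose-≤ i j α β β≡α = length-injection (contributing-unique j α)
      (λ {κ} κ∈ → S.recolor κ (proper κ∈))
      (λ {κ} {μ} κ∈ μ∈ → S.recolor-injective κ μ (proper κ∈) (proper μ∈))
      (λ {κ} κ∈ → Equivalence.from (∈-contributing j β _)
        ( S.recolor-proper κ (proper κ∈)
        , trans (S.asc-recolor κ (proper κ∈)) (proj₁ (proj₂ (contributes κ∈)))
        , content≡ κ∈))
      where
      module S = Swap G pca i
      contributes : ∀ {κ} → κ ∈ contributing j α → Contributes j α κ
      contributes = Equivalence.to (∈-contributing j α _)
      proper : ∀ {κ} → κ ∈ contributing j α → Proper κ
      proper κ∈ = proj₁ (contributes κ∈)
      content≡ : ∀ {κ} (κ∈ : κ ∈ contributing j α) → content (S.recolor κ (proper κ∈)) ≗ exponent β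
      content≡ {κ} κ∈ c = begin
        content κ′ c                             ≡⟨ cong (content κ′) (transpose-involutive i c) ⟨
        content κ′ (transpose i (transpose i c)) ≡⟨ S.content-recolor κ (proper κ∈) (transpose i c) ⟩
        content κ (transpose i c)                ≡⟨ proj₂ (proj₂ (contributes κ∈)) (transpose i c) ⟩
        exponent α (transpose i c)               ≡⟨ β≡α (transpose i c) ⟨
        exponent β (transpose i (transpose i c)) ≡⟨ cong (exponent β) (transpose-involutive i c) ⟩
        exponent β c                             ∎
        where
        open ≡-Reasoning
        κ′ : Coloring order
        κ′ = S.recolor κ (proper κ∈)

    coeff-transpose : ∀ j i α β → (∀ c → exponent β (transpose i c) ≡ exponent α c) →
      coeff (X G j) α ≡ coeff (X G j) β
    coeff-transpose j i α β β≡α = cong (λ c → pos c / 1) (≤-antisym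
      (contributing-transpose-≤ i j α β β≡α)
      -- The hypothesis is symmetric in `α` and `β` because the transposition is an involution.
      (contributing-transpose-≤ i j β α λ c →
        trans (sym (β≡α (transpose i c))) (cong (exponent β) (transpose-involutive i c))))

theorem9 : (G : Digraph) → ProperCircularArc G → X G ∈Λ[t]
theorem9 G pca = bounded-t-degree G , λ j →
  bounded-degree G j , AdjacentSymmetry.symmetric (X G j) (coeff-transpose G pca j)
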